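{- Let $G=(V,E)$ be a finite simple connected graph. Then $\beth^{2}(K^{\chi(G)})\le \beth^{2}(G)$; that is, $$\binom{\chi(G)}{3}-\binom{\chi(G)}{2}+\binom{\chi(G)}{1}\le \beth^{2}(G).$$
   Context: All graphs are finite and simple. $K^{t}$ is the complete graph on $t$ vertices and $\chi(G)$ is the chromatic number of $G$. $C(G)$ denotes the set of all induced cycles in $G$ (induced subgraphs of $G$ that are cycles, of length at least 3). The second graph characteristic is $\beth^{2}(G)=|C(G)|-|E(G)|+|V(G)|$. -}

module Defs where

open import Data.Fin using (Fin; toℕ; funToFin; finToFun) renaming (_<?_ to _<ᶠ?_)
open import Data.Fin.Properties using (_≟_; any?; all?; injective⇒≤; finToFun-funToFin)
open import Data.Fin.Subset using (Subset; _∈_; inside; outside)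
open import Data.Fin.Subset.Properties using (_∈?_)
open import Data.Integer using (ℤ; +_; _+_; _-_)
open import Data.List using (List; []; _∷_; _++_; map; filter; length; allFin; cartesianProduct)
open import Data.Nat as ℕ using (ℕ; zero; suc; _≤_; _<_; _^_)
open import Data.Nat.Induction using (<-rec)
open import Data.Nat.Properties using (anyUpTo?; ≮⇒≥; 1+n≢n; m≤n+m; ≤-trans)
open import Data.Product using (Σ; ∃; _×_; _,_; proj₁; proj₂; uncurry)
open import Data.Sum using (_⊎_; inj₁; inj₂; swap)
open import Data.Vec as Vec using ()
open import Function using (Injective; _⇔_; mk⇔; Equivalence; id)
open import Level using (0ℓ)
open import Relation.Binary using (Rel; Symmetric; Irreflexive; Decidable)
open import Relation.Binary.Construct.Closure.ReflexiveTransitive using (Star)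
open import Relation.Binary.PropositionalEquality
  using (_≡_; _≢_; _≗_; refl; sym; trans; subst₂; ≢-sym)
open import Relation.Nullary using (Dec; yes; no; ¬_)
open import Relation.Nullary.Decidable using (map′; ¬?; _×-dec_; _⊎-dec_; _→-dec_)
import Relation.Unary as U

private
  variable
    m n k : ℕ

record Graph (n : ℕ) : Set₁ where
  field
    Adj        : Rel (Fin n) 0ℓ
    adj?       : Decidable Adj
    adj-sym    : Symmetric Adj
    adj-irrefl : Irreflexive _≡_ Adj

open Graph

Connected : Graph n → Set
Connected G = ∀ u v → Star (Adj G) u v

K : ∀ t → Graph t
K t = record
  { Adj        = _≢_
  ; adj?       = λ u v → ¬? (u ≟ v)
  ; adj-sym    = ≢-sym
  ; adj-irrefl = λ u≡v u≢v → u≢v u≡v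
  }

-- cycle k is the cycle of length 3 + k, on vertices 0 , 1 , … , 2 + k in cyclic order.
Next : ∀ k → Rel (Fin (3 ℕ.+ k)) 0ℓ
Next k i j = toℕ j ≡ suc (toℕ i) ⊎ (toℕ i ≡ 2 ℕ.+ k × toℕ j ≡ 0)

cycle : ∀ k → Graph (3 ℕ.+ k)
cycle k = record
  { Adj        = λ i j → Next k i j ⊎ Next k j i
  ; adj?       = λ i j → next? i j ⊎-dec next? j i
  ; adj-sym    = swap
  ; adj-irrefl = λ { refl (inj₁ p) → ¬next p ; refl (inj₂ p) → ¬next p }
  }
  where
  next? : Decidable (Next k)
  next? i j = (toℕ j ℕ.≟ suc (toℕ i))
                ⊎-dec ((toℕ i ℕ.≟ 2 ℕ.+ k) ×-dec (toℕ j ℕ.≟ 0))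

  ¬next : ∀ {i} → ¬ Next k i i
  ¬next (inj₁ p)       = 1+n≢n (sym p)
  ¬next (inj₂ (p , q)) with trans (sym p) q
  ... | ()

∃-fun? : {P : (Fin m → Fin n) → Set} →
         (∀ {f g} → f ≗ g → P f → P g) → U.Decidable P → Dec (∃ P)
∃-fun? {m} {n} resp P? = map′
  (λ (i , p) → finToFun i , p)
  (λ (f , p) → funToFin f , resp (λ x → sym (finToFun-funToFin f x)) p)
  (any? (λ (i : Fin (n ^ m)) → P? (finToFun i)))

private
  _⇔-dec_ : {A B : Set} → Dec A → Dec B → Dec (A ⇔ B)
  a? ⇔-dec b? = map′ (uncurry mk⇔) (λ e → Equivalence.to e , Equivalence.from e)
                     ((a? →-dec b?) ×-dec (b? →-dec a?))

IsProper : Graph n → (Fin n → Fin k) → Set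
IsProper G c = ∀ u v → Adj G u v → c u ≢ c v

Colorable : Graph n → ℕ → Set
Colorable {n} G k = Σ (Fin n → Fin k) (IsProper G)

colorable? : (G : Graph n) → U.Decidable (Colorable G)
colorable? G k = ∃-fun?
  (λ f≗g p u v a e → p u v a (trans (f≗g u) (trans e (sym (f≗g v)))))
  (λ c → all? λ u → all? λ v → adj? G u v →-dec ¬? (c u ≟ c v))

IsLeast : (ℕ → Set) → ℕ → Set
IsLeast P k = P k × (∀ j → P j → k ≤ j)

least : {P : ℕ → Set} → U.Decidable P → ∀ m → P m → ∃ (IsLeast P)
least {P} P? = <-rec (λ m → P m → ∃ (IsLeast P)) step
  where
  step : ∀ m → (∀ {j} → j < m → P j → ∃ (IsLeast P)) → P m → ∃ (IsLeast P)
  step m rec p with anyUpTo? P? m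
  ... | yes (j , j<m , q) = rec j<m q
  ... | no  ∄             = m , p , λ j q → ≮⇒≥ (λ j<m → ∄ (j , j<m , q))

chromatic : (G : Graph n) → ∃ (IsLeast (Colorable G))
chromatic {n} G = least (colorable? G) n (id , λ u v a u≡v → adj-irrefl G u≡v a)

χ : Graph n → ℕ
χ G = proj₁ (chromatic G)

-- f is an isomorphism from H onto the subgraph of G induced by S.
IsInducedIso : Graph m → Graph n → Subset n → (Fin m → Fin n) → Set
IsInducedIso H G S f =
  Injective _≡_ _≡_ f ×
  (∀ i j → Adj H i j ⇔ Adj G (f i) (f j)) ×
  (∀ v → v ∈ S ⇔ ∃ λ i → f i ≡ v)

InducesCycle : Graph n → Subset n → Set
InducesCycle {n} G S =
  ∃ λ k → Σ (Fin (3 ℕ.+ k) → Fin n) (IsInducedIso (cycle k) G S)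

isInducedIso? : (H : Graph m) (G : Graph n) (S : Subset n) →
                U.Decidable (IsInducedIso H G S)
isInducedIso? H G S f =
  map′ (λ p {i} {j} → p i j) (λ p i j → p {i} {j})
    (all? λ i → all? λ j → (f i ≟ f j) →-dec (i ≟ j))
  ×-dec (all? λ i → all? λ j → adj? H i j ⇔-dec adj? G (f i) (f j))
  ×-dec (all? λ v → (v ∈? S) ⇔-dec any? λ i → f i ≟ v)

isInducedIso-resp : (H : Graph m) (G : Graph n) (S : Subset n) → ∀ {f g} →
                    f ≗ g → IsInducedIso H G S f → IsInducedIso H G S g
isInducedIso-resp H G S f≗g (inj , adj , img) =
  (λ {i} {j} e → inj (trans (f≗g i) (trans e (sym (f≗g j))))) ,
  (λ i j → mk⇔
    (λ a → subst₂ (Adj G) (f≗g i) (f≗g j) (Equivalence.to (adj i j) a))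
    (λ a → Equivalence.from (adj i j)
             (subst₂ (Adj G) (sym (f≗g i)) (sym (f≗g j)) a))) ,
  (λ v → mk⇔
    (λ v∈S → let (i , e) = Equivalence.to (img v) v∈S in i , trans (sym (f≗g i)) e)
    (λ (i , e) → Equivalence.from (img v) (i , trans (f≗g i) e)))

inducesCycle? : (G : Graph n) → U.Decidable (InducesCycle G)
inducesCycle? {n} G S = map′
  (λ (k , _ , p) → k , p)
  (λ (k , f , p) → k , ≤-trans (m≤n+m (suc k) 2) (injective⇒≤ (proj₁ p)) , f , p)
  (anyUpTo? (λ k → ∃-fun? (isInducedIso-resp (cycle k) G S)
                          (isInducedIso? (cycle k) G S)) n)

subsets : ∀ n → List (Subset n)
subsets zero    = Vec.[] ∷ []
subsets (suc n) = map (inside Vec.∷_) (subsets n) ++ map (outside Vec.∷_) (subsets n)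

-- An induced subgraph is determined by its vertex set, so the induced cycles
-- are listed, each once, as subsets of the vertices.
inducedCycles : Graph n → List (Subset n)
inducedCycles {n} G = filter (inducesCycle? G) (subsets n)

-- The edge {u , v} is listed once, as the pair (u , v) with u < v.
edges : Graph n → List (Fin n × Fin n)
edges {n} G = filter (λ (u , v) → (u <ᶠ? v) ×-dec adj? G u v)
                     (cartesianProduct (allFin n) (allFin n))

ℶ² : Graph n → ℤ
ℶ² {n} G = + length (inducedCycles G) - + length (edges G) + + n

{-# OPTIONS --safe #-}

-- Every nonempty graph has an avoidable vertex y: any two neighbours of y lie on an induced cycle
-- through y that contains no further neighbour of y. To find one, take a connected set D, maximal
-- among those with a nonempty far side F (the vertices outside D and its neighbourhood).
-- By maximality each neighbour of D is adjacent to all of F, so a vertex avoidable in F is avoidable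
-- in the whole graph: two neighbours of D are joined by an induced path through D.
--
-- Deleting an avoidable vertex of degree d loses d edges and at least C(d,2) induced cycles, one for
-- each pair of neighbours, so ℶ² drops by at least C(d,2) - d + 1 ≥ 0. Restoring the vertices in
-- reverse order and colouring greedily, colour number k+1 is opened only when d ≥ k, where that
-- increment is at least ℶ²(K^{k+1}) - ℶ²(K^k). Hence G is k-colourable for some k with
-- ℶ²(G) ≥ ℶ²(K^k).
module Submission where

open import Defs
open import Data.Nat using (ℕ)
open import Data.Nat.Combinatorics using (_C_)
open import Data.Integer using (+_; _+_; _-_; _≤_)
open import Data.Product using (_×_)

open import Data.Bool using (if_then_else_)
open import Data.Fin using (Fin; zero; suc; toℕ; fromℕ<) renaming (_<_ to _<ᶠ_)
import Data.Fin.Properties as Fin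
open import Data.Fin.Subset using (Subset; _∈_; _∉_; _⊆_; _⊂_; _∪_; ⁅_⁆; ∣_∣; ⊤; inside; outside; Nonempty)
  renaming (_-_ to _∖_)
open import Data.Fin.Subset.Induction using (⊂-wellFounded; ⊃-wellFounded)
open import Data.Fin.Subset.Properties
  using (_∈?_; nonempty?; ∈⊤; ∣⊤∣≡n; x∈⁅x⁆; x∈⁅y⁆⇒x≡y; ∣⁅x⁆∣≡1; p⊆p∪q; q⊆p∪q; x∈p∪q⁻; x∈p∪q⁺;
         p─q⊆p; x∈p∧x≢y⇒x∈p-y; x∈p⇒p-x⊂p; x∈p⇒∣p-x∣<∣p∣; p⊆q⇒∣p∣≤∣q∣)
open import Data.Integer using (-_; +≤+)
import Data.Integer.Properties as ℤ
open import Data.Integer.Solver using () renaming (module +-*-Solver to ℤ-Solver)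
open import Data.List using (List; []; _∷_; _++_; map; filter; length; lookup; allFin; upTo; cartesianProduct)
open import Data.List.Membership.Propositional using (lose) renaming (_∈_ to _∈ˡ_; _∉_ to _∉ˡ_)
open import Data.List.Membership.Propositional.Properties
  using (∈-∃++; ∈-++⁺ˡ; ∈-++⁺ʳ; ∈-++⁻; ∈-map⁺; ∈-map⁻; ∈-lookup; ∈-filter⁺; ∈-filter⁻; ∈-allFin;
         ∈-cartesianProduct⁺; ∈-upTo⁻)
import Data.List.Membership.DecPropositional as DecMembership
open import Data.List.Properties
  using (length-map; length-++; length-++-sucʳ; length-upTo; length-tabulate; filter-++; filter-none)
open import Data.List.Relation.Binary.Sublist.Propositional using (⊆-refl)
import Data.List.Relation.Binary.Sublist.Propositional.Properties as Sublist
open import Data.List.Relation.Binary.Subset.Propositional using () renaming (_⊆_ to _⊆ˡ_)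
open import Data.List.Relation.Unary.All as All using (All; []; _∷_)
open import Data.List.Relation.Unary.AllPairs using (AllPairs; []; _∷_)
import Data.List.Relation.Unary.AllPairs.Properties as AllPairs
open import Data.List.Relation.Unary.Any as Any using (Any; here; there; index)
open import Data.List.Relation.Unary.Any.Properties using (lookup-index)
open import Data.List.Relation.Unary.Unique.Propositional using (Unique)
import Data.List.Relation.Unary.Unique.Propositional.Properties as Unique
open import Data.Nat as ℕ using (zero; suc; z≤n; s≤s)
open import Data.Nat.Combinatorics using (nCk+nC[k+1]≡[n+1]C[k+1]; nC1≡n)
import Data.Nat.Properties as ℕ
open import Data.Nat.Solver using (module +-*-Solver)
open import Data.Product using (∃; _,_; proj₁; proj₂)
open import Data.Sum as Sum using (_⊎_; inj₁; inj₂)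
open import Data.Vec as Vec using ()
open import Data.Vec.Properties using (lookup⇒[]=; []=⇒lookup; lookup∘tabulate)
open import Function using (_∘_; id; _⇔_; mk⇔; Equivalence; Injective)
open import Induction.WellFounded using (Acc; acc)
open import Relation.Binary.Construct.Closure.ReflexiveTransitive as Star using (Star; ε; _◅_; _◅◅_)
open import Relation.Binary.PropositionalEquality
  using (_≡_; _≢_; refl; sym; trans; cong; cong₂; subst; module ≡-Reasoning)
open import Relation.Nullary using (¬_; Dec; yes; no; does; contradiction)
open import Relation.Nullary.Decidable using (dec-true; dec-false; ¬?; _×-dec_)
open import Relation.Unary using (Decidable)

open Equivalence using (to; from)

private
  variable
    n : ℕ
    A B : Set

-- Counting with duplicate-free lists and unordered pairs

length-mono-⊆ : {xs ys : List A} → Unique xs → xs ⊆ˡ ys → length xs ℕ.≤ length ys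
length-mono-⊆ {xs = []}     _        _   = z≤n
length-mono-⊆ {xs = x ∷ xs} (x∉ ∷ u) sub with ys₁ , ys₂ , refl ← ∈-∃++ (sub (here refl)) =
  ℕ.≤-trans (s≤s (length-mono-⊆ u sub′)) (ℕ.≤-reflexive (sym (length-++-sucʳ ys₁ x ys₂)))
  where
  sub′ : xs ⊆ˡ ys₁ ++ ys₂
  sub′ z∈ with ∈-++⁻ ys₁ (sub (there z∈))
  ... | inj₁ q           = ∈-++⁺ˡ q
  ... | inj₂ (here refl) = contradiction refl (All.lookup x∉ z∈)
  ... | inj₂ (there q)   = ∈-++⁺ʳ ys₁ q

pairs : List A → List (A × A)
pairs []       = []
pairs (x ∷ xs) = map (x ,_) xs ++ pairs xs

nC2-suc : ∀ m → suc m C 2 ≡ m ℕ.+ m C 2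
nC2-suc m = trans (sym (nCk+nC[k+1]≡[n+1]C[k+1] m 1)) (cong (ℕ._+ m C 2) (nC1≡n m))

length-pairs : (xs : List A) → length (pairs xs) ≡ length xs C 2
length-pairs []       = refl
length-pairs (x ∷ xs) = begin
  length (map (x ,_) xs ++ pairs xs)              ≡⟨ length-++ (map (x ,_) xs) ⟩
  length (map (x ,_) xs) ℕ.+ length (pairs xs)    ≡⟨ cong₂ ℕ._+_ (length-map (x ,_) xs) (length-pairs xs) ⟩
  length xs ℕ.+ length xs C 2                     ≡⟨ nC2-suc (length xs) ⟨
  suc (length xs) C 2                             ∎
  where open ≡-Reasoning

-- Used with `_<ᶠ_` to orient the pairs taken from a sorted list, and with `_≢_` to separate the two
-- components.
∈-pairs⁻ : {R : A → A → Set} {xs : List A} → AllPairs R xs →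
           ∀ {a b} → (a , b) ∈ˡ pairs xs → a ∈ˡ xs × b ∈ˡ xs × R a b
∈-pairs⁻ {xs = x ∷ xs} (Rx ∷ Rxs) ab∈ with ∈-++⁻ (map (x ,_) xs) ab∈
... | inj₁ q with _ , b∈ , refl ← ∈-map⁻ (x ,_) q = here refl , there b∈ , All.lookup Rx b∈
... | inj₂ q with a∈ , b∈ , Rab ← ∈-pairs⁻ Rxs q = there a∈ , there b∈ , Rab

pairs-unique : {xs : List A} → Unique xs → Unique (pairs xs)
pairs-unique []                         = []
pairs-unique {xs = x ∷ xs} (x∉ ∷ u) =
  Unique.++⁺ (Unique.map⁺ (cong proj₂) u) (pairs-unique u) disjoint
  where
  disjoint : ∀ {p} → p ∈ˡ map (x ,_) xs × p ∈ˡ pairs xs → _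
  disjoint (p , q) with _ , _ , refl ← ∈-map⁻ (x ,_) p = All.lookup x∉ (proj₁ (∈-pairs⁻ u q)) refl

-- Turns existence into a count: by `det`, witnesses chosen for distinct entries are distinct, so
-- there are as many of them as entries. The entries will be pairs of neighbours, the witnesses
-- induced cycles.
choose-unique : {Q : A → B → Set} {xs : List A} → Unique xs → (∀ {x} → x ∈ˡ xs → ∃ (Q x)) →
                (∀ {x y b} → x ∈ˡ xs → y ∈ˡ xs → Q x b → Q y b → x ≡ y) →
                ∃ λ ys → Unique ys × (∀ {b} → b ∈ˡ ys → ∃ λ x → x ∈ˡ xs × Q x b) ×
                         length ys ≡ length xs
choose-unique {xs = []} _ _ _ = [] , [] , (λ ()) , refl
choose-unique {xs = x ∷ xs} (x∉ ∷ u) choice det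
  with b , q ← choice (here refl)
     | ys , u′ , origin , len ← choose-unique u (choice ∘ there) (λ i j → det (there i) (there j)) =
  b ∷ ys , All.tabulate b∉ ∷ u′ , origin′ , cong suc len
  where
  b∉ : ∀ {z} → z ∈ˡ ys → b ≢ z
  b∉ z∈ refl with y , y∈ , q′ ← origin z∈ =
    All.lookup x∉ y∈ (det (here refl) (there y∈) q q′)
  origin′ : ∀ {z} → z ∈ˡ b ∷ ys → ∃ λ y → y ∈ˡ x ∷ xs × _
  origin′ (here refl) = x , here refl , q
  origin′ (there z∈)  with y , y∈ , q′ ← origin z∈ = y , there y∈ , q′

-- Subsets of a finite vertex set

module _ {P : Fin n → Set} (P? : Decidable P) where

  comprehension : Subset n
  comprehension = Vec.tabulate (λ x → does (P? x))

  ∈-comprehension⁺ : ∀ {x} → P x → x ∈ comprehension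
  ∈-comprehension⁺ {x} px =
    lookup⇒[]= x comprehension (trans (lookup∘tabulate _ x) (dec-true (P? x) px))

  ∈-comprehension⁻ : ∀ {x} → x ∈ comprehension → P x
  ∈-comprehension⁻ {x} x∈ with P? x | trans (sym (lookup∘tabulate (λ y → does (P? y)) x)) ([]=⇒lookup x∈)
  ... | yes px | _  = px
  ... | no _   | ()

allFin-sorted : ∀ n → AllPairs _<ᶠ_ (allFin n)
allFin-sorted n = AllPairs.tabulate⁺-< id

x∉p-x : ∀ (x : Fin n) (p : Subset n) → x ∉ p ∖ x
x∉p-x zero    (_ Vec.∷ p) ()
x∉p-x (suc x) (_ Vec.∷ p) (Vec.there x∈) = x∉p-x x p x∈

∣p∪q∣≤∣p∣+∣q∣ : ∀ (p q : Subset n) → ∣ p ∪ q ∣ ℕ.≤ ∣ p ∣ ℕ.+ ∣ q ∣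
∣p∪q∣≤∣p∣+∣q∣ Vec.[]            Vec.[]            = z≤n
∣p∪q∣≤∣p∣+∣q∣ (outside Vec.∷ p) (outside Vec.∷ q) = ∣p∪q∣≤∣p∣+∣q∣ p q
∣p∪q∣≤∣p∣+∣q∣ (outside Vec.∷ p) (inside Vec.∷ q)  =
  subst (suc ∣ p ∪ q ∣ ℕ.≤_) (sym (ℕ.+-suc ∣ p ∣ ∣ q ∣)) (s≤s (∣p∪q∣≤∣p∣+∣q∣ p q))
∣p∪q∣≤∣p∣+∣q∣ (inside Vec.∷ p)  (outside Vec.∷ q) = s≤s (∣p∪q∣≤∣p∣+∣q∣ p q)
∣p∪q∣≤∣p∣+∣q∣ (inside Vec.∷ p)  (inside Vec.∷ q)  =
  s≤s (ℕ.≤-trans (∣p∪q∣≤∣p∣+∣q∣ p q) (ℕ.+-monoʳ-≤ ∣ p ∣ (ℕ.n≤1+n ∣ q ∣)))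

-- Induced paths and the cycles they close up to

module Paths {n} (G : Graph n) where
  open Graph G
  open DecMembership (Fin._≟_ {n}) using () renaming (_∈?_ to _∈ˡ?_)

  -- The list omits the start vertex. Each vertex is tested only against those beyond its successor;
  -- symmetry of adjacency then excludes every chord.
  data InducedPath (b : Fin n) : Fin n → List (Fin n) → Set where
    end  : InducedPath b b []
    step : ∀ {a c r} → Adj a c → All (λ z → a ≢ z × ¬ Adj a z) r →
           InducedPath b c r → InducedPath b a (c ∷ r)

  InducedPathWithin : (Fin n → Set) → Fin n → Fin n → Set
  InducedPathWithin P a b = ∃ λ r → InducedPath b a r × All P (a ∷ r)

  mapWithin : ∀ {P Q : Fin n → Set} {a b} → (∀ {z} → P z → Q z) →
              InducedPathWithin P a b → InducedPathWithin Q a b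
  mapWithin P⇒Q (r , p , ps) = r , p , All.map P⇒Q ps

  edgePath : ∀ {P : Fin n → Set} {a b} → Adj a b → P a → P b → InducedPathWithin P a b
  edgePath a~b pa pb = _ , step a~b [] end , pa ∷ pb ∷ []

  suffix : ∀ {P b c r x} → InducedPath b c r → All P (c ∷ r) → x ∈ˡ c ∷ r → InducedPathWithin P x b
  suffix p            ps       (here refl) = _ , p , ps
  suffix (step _ _ p) (_ ∷ ps) (there x∈)  = suffix p ps x∈

  -- The path restarts at the last vertex adjacent to x, so that x has no later neighbour.
  prepend : ∀ {P : Fin n → Set} {b c r x} → InducedPath b c r → All P (c ∷ r) → P x → x ∉ˡ c ∷ r →
            Any (Adj x) (c ∷ r) → InducedPathWithin P x b
  prepend {r = r} {x} p ps px x∉ x~ with Any.any? (adj? x) r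
  prepend p            ps       px x∉ (there x~) | no  none = contradiction x~ none
  prepend p            ps       px x∉ (here x~c) | no  none =
    _ , step x~c (All.tabulate (λ z∈ → (λ { refl → x∉ (there z∈) }) , none ∘ lose z∈)) p , px ∷ ps
  prepend (step _ _ p) (_ ∷ ps) px x∉ _          | yes some = prepend p ps px (x∉ ∘ there) some

  -- If `x` is already on the path, the part from `x` onwards serves; otherwise `x` is joined to its
  -- last neighbour on the path.
  extend : ∀ {P : Fin n → Set} {b c x} → Adj x c → P x →
           InducedPathWithin P c b → InducedPathWithin P x b
  extend {c = c} {x} x~c px (r , p , ps) with x ∈ˡ? (c ∷ r)
  ... | yes x∈ = suffix p ps x∈
  ... | no  x∉ = prepend p ps px x∉ (here x~c)

  -- The vertices of the walk are put in front one by one, from its far end back to `x`, with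
  -- shortcuts taken on the way.
  extend* : ∀ {P : Fin n → Set} {b c x} → Star (λ u v → Adj u v × P u) x c →
            InducedPathWithin P c b → InducedPathWithin P x b
  extend* walk p = Star.fold (λ x c → InducedPathWithin _ c _ → InducedPathWithin _ x _)
                     (λ (x~y , px) k → extend x~y px ∘ k) (λ q → q) walk p

  end∈ : ∀ {a b r} → InducedPath b a r → b ∈ˡ a ∷ r
  end∈ end          = here refl
  end∈ (step _ _ p) = there (end∈ p)

  start≢tail : ∀ {a b r z} → InducedPath b a r → z ∈ˡ r → a ≢ z
  start≢tail (step a~c _ _) (here refl) refl = adj-irrefl refl a~c
  start≢tail (step _ far _) (there z∈)  a≡z  = proj₁ (All.lookup far z∈) a≡z

  lookup-injective : ∀ {a b r} → InducedPath b a r → Injective _≡_ _≡_ (lookup (a ∷ r))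
  lookup-injective p              {zero}  {zero}  _  = refl
  lookup-injective p              {zero}  {suc j} eq = contradiction eq (start≢tail p (∈-lookup j))
  lookup-injective p              {suc i} {zero}  eq = contradiction (sym eq) (start≢tail p (∈-lookup i))
  lookup-injective (step _ _ p)   {suc i} {suc j} eq = cong suc (lookup-injective p eq)

  lookup-end : ∀ {a b r} → InducedPath b a r → ∀ i → lookup (a ∷ r) i ≡ b ⇔ toℕ i ≡ length r
  lookup-end end            zero    = mk⇔ (λ _ → refl) (λ _ → refl)
  lookup-end p@(step _ _ q) zero    = mk⇔ (λ eq → contradiction eq (start≢tail p (end∈ q))) (λ ())
  lookup-end (step _ _ q)   (suc i) = mk⇔ (cong suc ∘ to (lookup-end q i))
                                          (from (lookup-end q i) ∘ ℕ.suc-injective)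

  lookup-adj₀ : ∀ {a b r} → InducedPath b a r → ∀ j → Adj a (lookup (a ∷ r) j) ⇔ toℕ j ≡ 1
  lookup-adj₀ p              zero          = mk⇔ (λ adj → contradiction adj (adj-irrefl refl)) (λ ())
  lookup-adj₀ (step a~c _ _) (suc zero)    = mk⇔ (λ _ → refl) (λ _ → a~c)
  lookup-adj₀ (step _ far _) (suc (suc j)) =
    mk⇔ (λ adj → contradiction adj (proj₂ (All.lookup far (∈-lookup j)))) (λ ())

  -- This is adjacency in `cycle` away from index 0, shifted down by one; the wrap-around of the
  -- cycle always involves index 0.
  lookup-adj : ∀ {a b r} → InducedPath b a r → ∀ i j →
               Adj (lookup (a ∷ r) i) (lookup (a ∷ r) j) ⇔ (toℕ j ≡ suc (toℕ i) ⊎ toℕ i ≡ suc (toℕ j))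
  lookup-adj p            zero    j       = mk⇔ (inj₁ ∘ to (lookup-adj₀ p j))
                                                λ { (inj₁ eq) → from (lookup-adj₀ p j) eq ; (inj₂ ()) }
  lookup-adj p            (suc i) zero    = mk⇔ (inj₂ ∘ to (lookup-adj₀ p (suc i)) ∘ adj-sym)
                                                λ { (inj₁ ()) ; (inj₂ eq) → adj-sym (from (lookup-adj₀ p (suc i)) eq) }
  lookup-adj (step _ _ p) (suc i) (suc j) =
    mk⇔ (Sum.map (cong suc) (cong suc) ∘ to (lookup-adj p i j))
        (from (lookup-adj p i j) ∘ Sum.map ℕ.suc-injective ℕ.suc-injective)

  vertexSet : List (Fin n) → Subset n
  vertexSet xs = comprehension (_∈ˡ? xs)

  ∈-vertexSet⁺ : ∀ xs {z} → z ∈ˡ xs → z ∈ vertexSet xs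
  ∈-vertexSet⁺ xs = ∈-comprehension⁺ (_∈ˡ? xs)

  ∈-vertexSet⁻ : ∀ xs {z} → z ∈ vertexSet xs → z ∈ˡ xs
  ∈-vertexSet⁻ xs = ∈-comprehension⁻ (_∈ˡ? xs)

  -- Required of every vertex of a path from `a` to `b`, so that closing the path through `y`
  -- creates no chord at `y`.
  OnlyNeighbours : Fin n → Fin n → Fin n → Fin n → Set
  OnlyNeighbours y a b z = z ≢ y × (Adj y z → z ≡ a ⊎ z ≡ b)

  -- Give `y` index 0 and number the path from 1: then `a` has index 1 and `b` the last index, the
  -- two cyclic neighbours of 0. As `a` and `b` differ, the path has at least two vertices and the
  -- cycle at least three.
  close-path : ∀ {y a b r} → a ≢ b → Adj y a → Adj y b → InducedPath b a r →
               All (OnlyNeighbours y a b) (a ∷ r) → InducesCycle G (vertexSet (y ∷ a ∷ r))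
  close-path a≢b _ _ end _ = contradiction refl a≢b
  close-path {y} {a} {b} {c ∷ r} _ y~a y~b p@(step _ _ _) only =
    k , f , (λ {i} {j} → injective i j) , adjacent , image
    where
    k = length r
    f : Fin (3 ℕ.+ k) → Fin n
    f = lookup (y ∷ a ∷ c ∷ r)

    ≢y : ∀ i → f (suc i) ≢ y
    ≢y i = proj₁ (All.lookup only (∈-lookup i))

    injective : ∀ i j → f i ≡ f j → i ≡ j
    injective zero    zero    _  = refl
    injective zero    (suc j) eq = contradiction (sym eq) (≢y j)
    injective (suc i) zero    eq = contradiction eq (≢y i)
    injective (suc i) (suc j) eq = cong suc (lookup-injective p eq)

    adjacent₀ : ∀ j → Graph.Adj (cycle k) zero (suc j) ⇔ Adj y (f (suc j))
    adjacent₀ j = mk⇔ there⇒ back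
      where
      there⇒ : Graph.Adj (cycle k) zero (suc j) → Adj y (f (suc j))
      there⇒ (inj₁ (inj₁ eq))       =
        subst (Adj y ∘ lookup (a ∷ c ∷ r)) (sym (Fin.toℕ-injective {j = zero} (ℕ.suc-injective eq))) y~a
      -- The wrap-around edge: index `2 + k` is the last one, which carries `b`.
      there⇒ (inj₂ (inj₂ (eq , _))) =
        subst (Adj y) (sym (from (lookup-end p j) (ℕ.suc-injective eq))) y~b

      back : Adj y (f (suc j)) → Graph.Adj (cycle k) zero (suc j)
      back adj with proj₂ (All.lookup only (∈-lookup j)) adj
      ... | inj₁ eq = inj₁ (inj₁ (cong (suc ∘ toℕ) (lookup-injective p {j} {zero} eq)))
      ... | inj₂ eq = inj₂ (inj₂ (cong suc (to (lookup-end p j) eq) , refl))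

    adjacent : ∀ i j → Graph.Adj (cycle k) i j ⇔ Adj (f i) (f j)
    adjacent zero    zero    = mk⇔ (λ adj → contradiction adj (Graph.adj-irrefl (cycle k) {zero} refl))
                                   (λ adj → contradiction adj (adj-irrefl refl))
    adjacent zero    (suc j) = adjacent₀ j
    adjacent (suc i) zero    = mk⇔ (adj-sym ∘ to (adjacent₀ i) ∘ Sum.swap)
                                   (Sum.swap ∘ from (adjacent₀ i) ∘ adj-sym)
    adjacent (suc i) (suc j) = mk⇔ there⇒ back
      where
      there⇒ : Graph.Adj (cycle k) (suc i) (suc j) → Adj (f (suc i)) (f (suc j))
      there⇒ (inj₁ (inj₁ eq)) = from (lookup-adj p i j) (inj₁ (ℕ.suc-injective eq))
      there⇒ (inj₂ (inj₁ eq)) = from (lookup-adj p i j) (inj₂ (ℕ.suc-injective eq))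

      back : Adj (f (suc i)) (f (suc j)) → Graph.Adj (cycle k) (suc i) (suc j)
      back adj = Sum.map (inj₁ ∘ cong suc) (inj₁ ∘ cong suc) (to (lookup-adj p i j) adj)

    image : ∀ v → v ∈ vertexSet (y ∷ a ∷ c ∷ r) ⇔ ∃ λ i → f i ≡ v
    image v = mk⇔
      (λ v∈ → let v∈ˡ = ∈-vertexSet⁻ (y ∷ a ∷ c ∷ r) v∈ in index v∈ˡ , sym (lookup-index v∈ˡ))
      (λ { (i , refl) → ∈-vertexSet⁺ (y ∷ a ∷ c ∷ r) (∈-lookup i) })

-- Binomial estimates

nC-mono-≤ : ∀ k {m n} → m ℕ.≤ n → m C suc k ℕ.≤ n C suc k
nC-mono-≤ k {m} m≤n = go (ℕ.≤⇒≤′ m≤n)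
  where
  go : ∀ {n} → m ℕ.≤′ n → m C suc k ℕ.≤ n C suc k
  go (ℕ.≤′-reflexive refl)  = ℕ.≤-refl
  go {suc n} (ℕ.≤′-step p) = ℕ.≤-trans (go p)
    (subst (n C suc k ℕ.≤_) (nCk+nC[k+1]≡[n+1]C[k+1] n k) (ℕ.m≤n+m (n C suc k) (n C k)))

-- ℶ² (K k), as a natural number: C(k,3) - C(k,2) + k = 1 + C(k-1,3) for k ≥ 1.
bethComplete : ℕ → ℕ
bethComplete zero    = 0
bethComplete (suc k) = suc (k C 3)

bethComplete-mono : ∀ {k l} → k ℕ.≤ l → bethComplete k ℕ.≤ bethComplete l
bethComplete-mono z≤n     = z≤n
bethComplete-mono (s≤s p) = s≤s (nC-mono-≤ 2 p)

-- By Pascal's rule C(k+1,3) - C(k+1,2) = C(k,3) - k, and adding k+1 leaves 1 + C(k,3).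
bethComplete-binomial : ∀ k → bethComplete k ℕ.+ k C 2 ≡ k C 3 ℕ.+ k
bethComplete-binomial zero    = refl
bethComplete-binomial (suc k)
  rewrite nC2-suc k | sym (nCk+nC[k+1]≡[n+1]C[k+1] k 2) =
  solve 3 (λ c₃ k c₂ → con 1 :+ c₃ :+ (k :+ c₂) := c₂ :+ c₃ :+ (con 1 :+ k)) refl (k C 3) k (k C 2)
  where open +-*-Solver

-- Here d counts new edges, d C 2 new cycles, and 1 the new vertex.
degree-bound : ∀ d → d ℕ.≤ d C 2 ℕ.+ 1
degree-bound zero    = z≤n
degree-bound (suc e) rewrite nC2-suc e | ℕ.+-comm (e ℕ.+ e C 2) 1 = s≤s (ℕ.m≤m+n e (e C 2))

-- By Pascal's rule `bethComplete` rises by C(k,2) here. With d = e+1, the gain C(d,2) + 1 - d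
-- equals C(e,2), and k ≤ e.
degree-bound-suc : ∀ {k d} → suc k ℕ.≤ d →
                   d ℕ.+ bethComplete (suc (suc k)) ℕ.≤ d C 2 ℕ.+ 1 ℕ.+ bethComplete (suc k)
degree-bound-suc {k} {suc e} (s≤s k≤e)
  rewrite nC2-suc e | sym (nCk+nC[k+1]≡[n+1]C[k+1] k 2) = begin
  suc e ℕ.+ suc (k C 2 ℕ.+ k C 3)
    ≤⟨ ℕ.+-monoʳ-≤ (suc e) (s≤s (ℕ.+-monoˡ-≤ (k C 3) (nC-mono-≤ 1 k≤e))) ⟩
  suc e ℕ.+ suc (e C 2 ℕ.+ k C 3)
    ≡⟨ solve 3 (λ e x y → con 1 :+ e :+ (con 1 :+ (x :+ y)) := e :+ x :+ con 1 :+ (con 1 :+ y)) refl e (e C 2) (k C 3) ⟩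
  e ℕ.+ e C 2 ℕ.+ 1 ℕ.+ suc (k C 3) ∎
  where
  open ℕ.≤-Reasoning
  open +-*-Solver

-- Existence of avoidable vertices

module Avoidability {n} (G : Graph n) where
  open Graph G
  open Paths G

  -- The path from a to b closes up with y to an induced cycle.
  Avoidable : Subset n → Fin n → Set
  Avoidable U y = y ∈ U × (∀ {a b} → a ∈ U → b ∈ U → Adj y a → Adj y b → a ≢ b →
                           InducedPathWithin (λ z → z ∈ U × OnlyNeighbours y a b z) a b)

  module _ (U : Subset n) where

    Touches : Subset n → Fin n → Set
    Touches D a = ∃ λ d → d ∈ D × Adj d a

    touches? : ∀ D a → Dec (Touches D a)
    touches? D a = Fin.any? λ d → (d ∈? D) ×-dec adj? d a

    Far : Subset n → Fin n → Set
    Far D x = x ∈ U × x ∉ D × ¬ Touches D x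

    far? : ∀ D x → Dec (Far D x)
    far? D x = (x ∈? U) ×-dec ¬? (x ∈? D) ×-dec ¬? (touches? D x)

    -- Both endpoints are recorded so that a walk inside `D` can be reversed.
    Inside : Subset n → Fin n → Fin n → Set
    Inside D u v = Adj u v × u ∈ D × v ∈ D

    -- Connectedness is kept as walks to one root, which makes adding a vertex easy; two such walks,
    -- one reversed, join any two vertices.
    record Region (r : Fin n) (D : Subset n) : Set where
      field
        root∈     : r ∈ D
        within    : D ⊆ U
        connected : ∀ {x} → x ∈ D → Star (Inside D) x r

    open Region

    -- If a were not adjacent to x, then D ∪ ⁅ a ⁆ would still have x on its far side.
    Maximal : Subset n → Set
    Maximal D = ∀ {a x} → a ∈ U → a ∉ D → Touches D a → Far D x → Adj a x

    add : ∀ {r D a} → Region r D → a ∈ U → Touches D a → Region r (D ∪ ⁅ a ⁆)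
    add {r} {D} {a} R a∈U (d , d∈D , d~a) = record
      { root∈     = p⊆p∪q ⁅ a ⁆ (root∈ R)
      ; within    = λ x∈ → Sum.[ within R , (λ x∈a → subst (_∈ U) (sym (x∈⁅y⁆⇒x≡y a x∈a)) a∈U) ]′
                             (x∈p∪q⁻ D ⁅ a ⁆ x∈)
      ; connected = λ x∈ → Sum.[ widen , (λ x∈a → subst (λ x → Star (Inside (D ∪ ⁅ a ⁆)) x r)
                                                    (sym (x∈⁅y⁆⇒x≡y a x∈a)) new) ]′
                             (x∈p∪q⁻ D ⁅ a ⁆ x∈)
      }
      where
      D⊆ : D ⊆ D ∪ ⁅ a ⁆
      D⊆ = p⊆p∪q ⁅ a ⁆
      widen : ∀ {x} → x ∈ D → Star (Inside (D ∪ ⁅ a ⁆)) x r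
      widen x∈ = Star.map (λ (u~v , u∈ , v∈) → u~v , D⊆ u∈ , D⊆ v∈) (connected R x∈)
      new : Star (Inside (D ∪ ⁅ a ⁆)) a r
      new = (adj-sym d~a , q⊆p∪q D ⁅ a ⁆ (x∈⁅x⁆ a) , D⊆ d∈D) ◅ widen d∈D

    -- A vertex `a` violating maximality is added to `D`, and its non-neighbour `x` keeps the far
    -- side nonempty. The growth of `D` ends because the vertex set is finite.
    maximalRegion : ∀ {r D} → Acc (λ p q → q ⊂ p) D → Region r D → ∃ (Far D) →
                    ∃ λ D′ → Region r D′ × ∃ (Far D′) × Maximal D′
    maximalRegion {r} {D} (acc rec) R far
      with Fin.any? (λ a → Fin.any? λ x →
             (a ∈? U) ×-dec ¬? (a ∈? D) ×-dec touches? D a ×-dec far? D x ×-dec ¬? (adj? a x))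
    ... | no none = D , R , far , λ {a} {x} a∈U a∉D ta fx → decide a x a∈U a∉D ta fx
      where
      decide : ∀ a x → a ∈ U → a ∉ D → Touches D a → Far D x → Adj a x
      decide a x a∈U a∉D ta fx with adj? a x
      ... | yes a~x = a~x
      ... | no  a≁x = contradiction (a , x , a∈U , a∉D , ta , fx , a≁x) none
    ... | yes (a , x , a∈U , a∉D , ta , (x∈U , x∉D , x-far) , a≁x) =
      maximalRegion (rec (p⊆p∪q ⁅ a ⁆ , a , q⊆p∪q D ⁅ a ⁆ (x∈⁅x⁆ a) , a∉D)) (add R a∈U ta)
        (x , x∈U , x∉ , far′)
      where
      -- `x` differs from `a`, because `a` touches `D` and `x` does not.
      x∉ : x ∉ D ∪ ⁅ a ⁆
      x∉ x∈ with x∈p∪q⁻ D ⁅ a ⁆ x∈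
      ... | inj₁ x∈D = x∉D x∈D
      ... | inj₂ x∈a with refl ← x∈⁅y⁆⇒x≡y a x∈a = x-far ta
      far′ : ¬ Touches (D ∪ ⁅ a ⁆) x
      far′ (d , d∈ , d~x) with x∈p∪q⁻ D ⁅ a ⁆ d∈
      ... | inj₁ d∈D = x-far (d , d∈D , d~x)
      ... | inj₂ d∈a with refl ← x∈⁅y⁆⇒x≡y a d∈a = a≁x d~x

    -- Join `a` to some `d` in `D`, go to the root and on to some `e` in `D`, then to `b`; this walk
    -- shortens to an induced path.
    through : ∀ {r D a b} → Region r D → Touches D a → Touches D b →
              InducedPathWithin (λ z → z ∈ D ⊎ z ≡ a ⊎ z ≡ b) a b
    through R (d , d∈ , d~a) (e , e∈ , e~b) =
      extend (adj-sym d~a) (inj₂ (inj₁ refl))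
        (extend* (Star.map (λ (u~v , u∈ , _) → u~v , inj₁ u∈) walk)
          (edgePath e~b (inj₁ e∈) (inj₂ (inj₂ refl))))
      where
      walk = connected R d∈ ◅◅ Star.reverse (λ (u~v , u∈ , v∈) → adj-sym u~v , v∈ , u∈) (connected R e∈)

    -- Every neighbour of y outside the far side touches D, hence is adjacent to all of the far side.
    lift-avoidable : ∀ {r D y} → Region r D → Maximal D → Avoidable (comprehension (far? D)) y → Avoidable U y
    lift-avoidable {r} {D} {y} R max (y∈F , paths) = y∈U , paths′
      where
      F : Subset n
      F = comprehension (far? D)

      F-far : ∀ {x} → x ∈ F → Far D x
      F-far = ∈-comprehension⁻ (far? D)

      y∈U : y ∈ U
      y∈U = proj₁ (F-far y∈F)

      y∉D : y ∉ D
      y∉D = proj₁ (proj₂ (F-far y∈F))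

      y-far : ¬ Touches D y
      y-far = proj₂ (proj₂ (F-far y∈F))

      ~⇒≢ : ∀ {x} → Adj y x → x ≢ y
      ~⇒≢ y~x x≡y = adj-irrefl (sym x≡y) y~x

      side : ∀ {a} → a ∈ U → Adj y a → a ∈ F ⊎ a ∉ D × Touches D a
      side {a} a∈U y~a with touches? D a
      ... | yes ta = inj₂ ((λ a∈D → y-far (a , a∈D , adj-sym y~a)) , ta)
      ... | no ¬ta = inj₁ (∈-comprehension⁺ (far? D) (a∈U , (λ a∈D → y-far (a , a∈D , adj-sym y~a)) , ¬ta))

      paths′ : ∀ {a b} → a ∈ U → b ∈ U → Adj y a → Adj y b → a ≢ b →
               InducedPathWithin (λ z → z ∈ U × OnlyNeighbours y a b z) a b
      paths′ {a} {b} a∈U b∈U y~a y~b a≢b = go (side a∈U y~a) (side b∈U y~b)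
        where
        a-ok : a ∈ U × OnlyNeighbours y a b a
        a-ok = a∈U , ~⇒≢ y~a , λ _ → inj₁ refl
        b-ok : b ∈ U × OnlyNeighbours y a b b
        b-ok = b∈U , ~⇒≢ y~b , λ _ → inj₂ refl
        ok : ∀ {z} → z ∈ D ⊎ z ≡ a ⊎ z ≡ b → z ∈ U × OnlyNeighbours y a b z
        ok (inj₁ z∈D)         = within R z∈D , (λ { refl → y∉D z∈D }) ,
                                λ y~z → contradiction (_ , z∈D , adj-sym y~z) y-far
        ok (inj₂ (inj₁ refl)) = a-ok
        ok (inj₂ (inj₂ refl)) = b-ok
        -- Both in `F`: avoidability in `F` gives the path. One in `F`: maximality makes `a` and `b`
        -- adjacent. Neither: the path runs through `D`, which contains no neighbour of `y`.
        go : a ∈ F ⊎ a ∉ D × Touches D a → b ∈ F ⊎ b ∉ D × Touches D b → _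
        go (inj₁ a∈F)        (inj₁ b∈F)        =
          mapWithin (λ (z∈F , only) → proj₁ (F-far z∈F) , only) (paths a∈F b∈F y~a y~b a≢b)
        go (inj₁ a∈F)        (inj₂ (b∉D , tb)) = edgePath (adj-sym (max b∈U b∉D tb (F-far a∈F))) a-ok b-ok
        go (inj₂ (a∉D , ta)) (inj₁ b∈F)        = edgePath (max a∈U a∉D ta (F-far b∈F)) a-ok b-ok
        go (inj₂ (_ , ta))   (inj₂ (_ , tb))   = mapWithin ok (through R ta tb)

  singletonRegion : ∀ {U u} → u ∈ U → Region U u ⁅ u ⁆
  singletonRegion {U} {u} u∈U = record
    { root∈     = x∈⁅x⁆ u
    ; within    = λ z∈ → subst (_∈ U) (sym (x∈⁅y⁆⇒x≡y u z∈)) u∈U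
    ; connected = λ z∈ → subst (λ z → Star (Inside U ⁅ u ⁆) z u) (sym (x∈⁅y⁆⇒x≡y u z∈)) ε
    }

  -- In a clique any vertex works, the path being a single edge. Otherwise a region is grown from
  -- one end `u` of a non-edge, the other end being far at first; the far side omits `u`, so the
  -- recursion descends.
  avoidable-exists : ∀ U → Acc _⊂_ U → Nonempty U → ∃ (Avoidable U)
  avoidable-exists U (acc rec) (y , y∈U)
    with Fin.any? (λ u → Fin.any? λ x → (u ∈? U) ×-dec (x ∈? U) ×-dec ¬? (u Fin.≟ x) ×-dec ¬? (adj? u x))
  ... | no complete = y , y∈U , λ {a} {b} a∈U b∈U y~a y~b a≢b → edgePath (adjacent a b a∈U b∈U a≢b)
        (a∈U , (λ { refl → adj-irrefl refl y~a }) , λ _ → inj₁ refl)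
        (b∈U , (λ { refl → adj-irrefl refl y~b }) , λ _ → inj₂ refl)
    where
    adjacent : ∀ a b → a ∈ U → b ∈ U → a ≢ b → Adj a b
    adjacent a b a∈U b∈U a≢b with adj? a b
    ... | yes a~b = a~b
    ... | no  a≁b = contradiction (a , b , a∈U , b∈U , a≢b , a≁b) complete
  ... | yes (u , x , u∈U , x∈U , u≢x , u≁x)
    with D , R , (x′ , far) , max ← maximalRegion U (⊃-wellFounded ⁅ u ⁆) (singletonRegion u∈U)
           (x , x∈U , (λ x∈u → u≢x (sym (x∈⁅y⁆⇒x≡y u x∈u))) ,
            λ (d , d∈u , d~x) → u≁x (subst (λ d → Adj d x) (x∈⁅y⁆⇒x≡y u d∈u) d~x))
    = let F⊂U : comprehension (far? U D) ⊂ U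
          F⊂U = (proj₁ ∘ ∈-comprehension⁻ (far? U D)) , u , u∈U ,
                (λ u∈F → proj₁ (proj₂ (∈-comprehension⁻ (far? U D) u∈F)) (Region.root∈ R))
          y′ , av = avoidable-exists (comprehension (far? U D)) (rec F⊂U)
                      (x′ , ∈-comprehension⁺ (far? U D) far)
      in y′ , lift-avoidable U R max av

-- Restoring avoidable vertices with greedy colouring

module Induction {n} (G : Graph n) where
  open Graph G
  open Paths G
  open Avoidability G
  open DecMembership ℕ._≟_ using () renaming (_∈?_ to _∈ℕ?_)

  -- The inequality ℶ² (K k) ≤ ∣ cycles ∣ - ∣ links ∣ + ∣ U ∣, with the subtraction moved across.
  record Bound (U : Subset n) : Set where
    field
      k       : ℕ
      colour  : Fin n → ℕ
      colour< : ∀ {x} → x ∈ U → colour x ℕ.< k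
      proper  : ∀ {x y} → x ∈ U → y ∈ U → Adj x y → colour x ≢ colour y
      cycles  : List (Subset n)
      unique  : Unique cycles
      induced : ∀ {S} → S ∈ˡ cycles → S ⊆ U × InducesCycle G S
      links   : List (Fin n × Fin n)
      covers  : ∀ {u v} → u ∈ U → v ∈ U → u <ᶠ v → Adj u v → (u , v) ∈ˡ links
      bound   : length links ℕ.+ bethComplete k ℕ.≤ length cycles ℕ.+ ∣ U ∣

  module _ {U : Subset n} {y : Fin n} (avoidable : Avoidable U y) (B : Bound (U ∖ y)) where
    open Bound B

    neighbour? : Decidable (λ w → w ∈ U × Adj y w)
    neighbour? w = (w ∈? U) ×-dec adj? y w

    neighbours : List (Fin n)
    neighbours = filter neighbour? (allFin n)

    degree : ℕ
    degree = length neighbours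

    ∈-neighbours⁺ : ∀ {w} → w ∈ U → Adj y w → w ∈ˡ neighbours
    ∈-neighbours⁺ w∈U y~w = ∈-filter⁺ neighbour? (∈-allFin _) (w∈U , y~w)

    ∈-neighbours⁻ : ∀ {w} → w ∈ˡ neighbours → w ∈ U × Adj y w
    ∈-neighbours⁻ w∈ = proj₂ (∈-filter⁻ neighbour? {xs = allFin n} w∈)

    neighbours-sorted : AllPairs _<ᶠ_ neighbours
    neighbours-sorted = AllPairs.filter⁺ neighbour? (allFin-sorted n)

    neighbours-unique : Unique neighbours
    neighbours-unique = Unique.filter⁺ neighbour? (Unique.allFin⁺ n)

    -- Containing `y` sets `S` apart from the cycles found before; meeting the neighbourhood of `y`
    -- only in `a` and `b` lets `S` recover its pair.
    CycleVia : Fin n × Fin n → Subset n → Set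
    CycleVia (a , b) S = S ⊆ U × InducesCycle G S × y ∈ S × a ∈ S × b ∈ S ×
                         (∀ {z} → z ∈ S → Adj y z → z ≡ a ⊎ z ≡ b)

    cycleVia : ∀ {p} → p ∈ˡ pairs neighbours → ∃ (CycleVia p)
    cycleVia {a , b} p∈
      with a∈ , b∈ , a<b ← ∈-pairs⁻ neighbours-sorted p∈
      with a∈U , y~a ← ∈-neighbours⁻ a∈ | b∈U , y~b ← ∈-neighbours⁻ b∈
      with r , path , ok ← proj₂ avoidable a∈U b∈U y~a y~b (Fin.<⇒≢ a<b) =
      vertexSet vs , S⊆U , close-path (Fin.<⇒≢ a<b) y~a y~b path (All.map proj₂ ok) ,
      ∈-vertexSet⁺ vs (here refl) , ∈-vertexSet⁺ vs (there (here refl)) , ∈-vertexSet⁺ vs (there (end∈ path)) , only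
      where
      vs : List (Fin n)
      vs = y ∷ a ∷ r
      S⊆U : vertexSet vs ⊆ U
      S⊆U z∈ with ∈-vertexSet⁻ vs z∈
      ... | here refl = proj₁ avoidable
      ... | there z∈r = proj₁ (All.lookup ok z∈r)
      only : ∀ {z} → z ∈ vertexSet vs → Adj y z → z ≡ a ⊎ z ≡ b
      only z∈ y~z with ∈-vertexSet⁻ vs z∈
      ... | here refl = contradiction y~z (adj-irrefl refl)
      ... | there z∈r = proj₂ (proj₂ (All.lookup ok z∈r)) y~z

    -- Pairs are listed in increasing order, so a cycle through y determines its pair of neighbours of y.
    cycleVia-determines : ∀ {p q S} → p ∈ˡ pairs neighbours → q ∈ˡ pairs neighbours →
                          CycleVia p S → CycleVia q S → p ≡ q
    cycleVia-determines {a , b} {c , d} p∈ q∈ (_ , _ , _ , _ , _ , only) (_ , _ , _ , c∈S , d∈S , _)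
      with _ , _ , a<b ← ∈-pairs⁻ neighbours-sorted p∈ | c∈ , d∈ , c<d ← ∈-pairs⁻ neighbours-sorted q∈
      with only c∈S (proj₂ (∈-neighbours⁻ c∈)) | only d∈S (proj₂ (∈-neighbours⁻ d∈))
    ... | inj₁ refl | inj₁ refl = contradiction c<d (Fin.<-irrefl refl)
    ... | inj₁ refl | inj₂ refl = refl
    ... | inj₂ refl | inj₁ refl = contradiction c<d (Fin.<-asym a<b)
    ... | inj₂ refl | inj₂ refl = contradiction c<d (Fin.<-irrefl refl)

    -- Smaller endpoint first, to match `edges`.
    edgeTo : Fin n → Fin n × Fin n
    edgeTo w = if does (w Fin.<? y) then (w , y) else (y , w)

    edgeTo-< : ∀ {w} → w <ᶠ y → edgeTo w ≡ (w , y)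
    edgeTo-< {w} w<y rewrite dec-true (w Fin.<? y) w<y = refl

    edgeTo-> : ∀ {w} → y <ᶠ w → edgeTo w ≡ (y , w)
    edgeTo-> {w} y<w rewrite dec-false (w Fin.<? y) (Fin.<-asym y<w) = refl

    module _ (k′ new : ℕ) (k≤k′ : k ℕ.≤ k′) (new<k′ : new ℕ.< k′) (fresh : new ∉ˡ map colour neighbours)
             (growth : degree ℕ.+ bethComplete k′ ℕ.≤ degree C 2 ℕ.+ 1 ℕ.+ bethComplete k) where

      recolour : Fin n → ℕ
      recolour x = if does (x Fin.≟ y) then new else colour x

      recolour< : ∀ {x} → x ∈ U → recolour x ℕ.< k′
      recolour< {x} x∈U with x Fin.≟ y
      ... | yes _   = new<k′
      ... | no  x≢y = ℕ.<-≤-trans (colour< (x∈p∧x≢y⇒x∈p-y x∈U x≢y)) k≤k′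

      recolour-proper : ∀ {x z} → x ∈ U → z ∈ U → Adj x z → recolour x ≢ recolour z
      recolour-proper {x} {z} x∈U z∈U x~z eq with x Fin.≟ y | z Fin.≟ y
      ... | yes refl | yes refl = adj-irrefl refl x~z
      ... | yes refl | no  z≢y  = fresh (subst (_∈ˡ _) (sym eq) (∈-map⁺ colour (∈-neighbours⁺ z∈U x~z)))
      ... | no  x≢y  | yes refl = fresh (subst (_∈ˡ _) eq (∈-map⁺ colour (∈-neighbours⁺ x∈U (adj-sym x~z))))
      ... | no  x≢y  | no  z≢y  = proper (x∈p∧x≢y⇒x∈p-y x∈U x≢y) (x∈p∧x≢y⇒x∈p-y z∈U z≢y) x~z eq

      links′ : List (Fin n × Fin n)
      links′ = map edgeTo neighbours ++ links

      covers′ : ∀ {u v} → u ∈ U → v ∈ U → u <ᶠ v → Adj u v → (u , v) ∈ˡ links′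
      covers′ {u} {v} u∈U v∈U u<v u~v with u Fin.≟ y | v Fin.≟ y
      ... | yes refl | _        =
        ∈-++⁺ˡ (subst (_∈ˡ _) (edgeTo-> u<v) (∈-map⁺ edgeTo (∈-neighbours⁺ v∈U u~v)))
      ... | no  _    | yes refl =
        ∈-++⁺ˡ (subst (_∈ˡ _) (edgeTo-< u<v) (∈-map⁺ edgeTo (∈-neighbours⁺ u∈U (adj-sym u~v))))
      ... | no  u≢y  | no  v≢y  =
        ∈-++⁺ʳ (map edgeTo neighbours)
          (covers (x∈p∧x≢y⇒x∈p-y u∈U u≢y) (x∈p∧x≢y⇒x∈p-y v∈U v≢y) u<v u~v)

      -- Serves both colouring cases: an old colour with `k′` equal to `k`, or the new colour `k`
      -- with `k′` equal to `suc k`.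
      addVertex : Bound U
      addVertex
        with new-cycles , new-unique , origin , len ←
               choose-unique (pairs-unique neighbours-unique) cycleVia cycleVia-determines = record
        { k       = k′
        ; colour  = recolour
        ; colour< = recolour<
        ; proper  = recolour-proper
        ; cycles  = new-cycles ++ cycles
        ; unique  = Unique.++⁺ new-unique unique disjoint
        ; induced = induced′
        ; links   = links′
        ; covers  = covers′
        ; bound   = bound′
        }
        where
        -- New cycles pass through `y`; the old ones lie in the set from which `y` was deleted.
        disjoint : ∀ {S} → S ∈ˡ new-cycles × S ∈ˡ cycles → _
        disjoint (S∈new , S∈old) with _ , _ , _ , _ , y∈S , _ ← origin S∈new =
          x∉p-x y U (proj₁ (induced S∈old) y∈S)

        induced′ : ∀ {S} → S ∈ˡ new-cycles ++ cycles → S ⊆ U × InducesCycle G S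
        induced′ S∈ with ∈-++⁻ new-cycles S∈
        ... | inj₁ S∈new with _ , _ , S⊆U , cyc , _ ← origin S∈new = S⊆U , cyc
        ... | inj₂ S∈old with S⊆U∖y , cyc ← induced S∈old = (λ z∈ → p─q⊆p U ⁅ y ⁆ (S⊆U∖y z∈)) , cyc

        bound′ : length links′ ℕ.+ bethComplete k′ ℕ.≤ length (new-cycles ++ cycles) ℕ.+ ∣ U ∣
        bound′
          rewrite length-++ (map edgeTo neighbours) {links} | length-map edgeTo neighbours
                | length-++ new-cycles {cycles} | len | length-pairs neighbours =
          -- Adding `growth` and `bound` puts `bethComplete k` on both sides, where it cancels; the
          -- 1 in `growth` pays for the vertex `y`.
          ℕ.+-cancelʳ-≤ (bethComplete k) _ _ (begin
            d ℕ.+ l ℕ.+ bethComplete k′ ℕ.+ bethComplete k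
              ≡⟨ solve 4 (λ d l f g → d :+ l :+ f :+ g := d :+ f :+ (l :+ g)) refl d l (bethComplete k′) (bethComplete k) ⟩
            d ℕ.+ bethComplete k′ ℕ.+ (l ℕ.+ bethComplete k)
              ≤⟨ ℕ.+-mono-≤ growth bound ⟩
            d C 2 ℕ.+ 1 ℕ.+ bethComplete k ℕ.+ (c ℕ.+ ∣ U ∖ y ∣)
              ≡⟨ solve 4 (λ t g c u → t :+ con 1 :+ g :+ (c :+ u) := t :+ c :+ (con 1 :+ u) :+ g) refl
                   (d C 2) (bethComplete k) c ∣ U ∖ y ∣ ⟩
            d C 2 ℕ.+ c ℕ.+ suc ∣ U ∖ y ∣ ℕ.+ bethComplete k
              ≤⟨ ℕ.+-monoˡ-≤ (bethComplete k) (ℕ.+-monoʳ-≤ (d C 2 ℕ.+ c) (x∈p⇒∣p-x∣<∣p∣ (proj₁ avoidable))) ⟩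
            d C 2 ℕ.+ c ℕ.+ ∣ U ∣ ℕ.+ bethComplete k ∎)
          where
          open ℕ.≤-Reasoning
          open +-*-Solver
          d = degree
          l = length links
          c = length cycles

    module _ (none : ¬ ∃ λ j → j ℕ.< k × j ∉ˡ map colour neighbours) where

      -- Pigeonhole: all `k` colours occur in the list of the neighbours' colours.
      k≤degree : k ℕ.≤ degree
      k≤degree = begin
        k                             ≡⟨ length-upTo k ⟨
        length (upTo k)               ≤⟨ length-mono-⊆ (Unique.upTo⁺ k) used ⟩
        length (map colour neighbours) ≡⟨ length-map colour neighbours ⟩
        degree                        ∎
        where
        open ℕ.≤-Reasoning
        used : upTo k ⊆ˡ map colour neighbours
        used {j} j∈ with j ∈ℕ? map colour neighbours
        ... | yes j∈c = j∈c
        ... | no  j∉c = contradiction (j , ∈-upTo⁻ j∈ , j∉c) none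

    neighbour-colour< : ∀ {w} → w ∈ˡ neighbours → colour w ℕ.< k
    neighbour-colour< w∈ with w∈U , y~w ← ∈-neighbours⁻ w∈ =
      colour< (x∈p∧x≢y⇒x∈p-y w∈U (λ { refl → adj-irrefl refl y~w }))

    fresh-k : k ∉ˡ map colour neighbours
    fresh-k k∈ with w , w∈ , k≡ ← ∈-map⁻ colour k∈ = ℕ.<-irrefl (sym k≡) (neighbour-colour< w∈)

    -- For `k = 0` no neighbour can have a colour below `k`, so the degree is 0 and both sides are
    -- 1; the other values are `degree-bound-suc`.
    growth-suc : k ℕ.≤ degree → degree ℕ.+ bethComplete (suc k) ℕ.≤ degree C 2 ℕ.+ 1 ℕ.+ bethComplete k
    growth-suc = go k neighbours neighbour-colour<
      where
      -- `k` and the neighbour list become variables so that they can be matched on.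
      go : ∀ k ws → (∀ {w} → w ∈ˡ ws → colour w ℕ.< k) → k ℕ.≤ length ws →
           length ws ℕ.+ bethComplete (suc k) ℕ.≤ length ws C 2 ℕ.+ 1 ℕ.+ bethComplete k
      go zero    []      _  _   = ℕ.≤-refl
      go zero    (w ∷ _) lt _   = contradiction (lt (here refl)) ℕ.n≮0
      go (suc k) ws      _  k≤d = degree-bound-suc k≤d

    -- A colour missing around `y` is reused, at the cost of `degree-bound` only. If none is
    -- missing, colour `k` is opened and the large degree pays for the rise of `bethComplete`.
    insertAvoidable : Bound U
    insertAvoidable with ℕ.anyUpTo? (λ j → ¬? (j ∈ℕ? map colour neighbours)) k
    ... | yes (j , j<k , fresh) =
      addVertex k j ℕ.≤-refl j<k fresh (ℕ.+-monoˡ-≤ (bethComplete k) (degree-bound degree))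
    ... | no none = addVertex (suc k) k (ℕ.n≤1+n k) ℕ.≤-refl fresh-k (growth-suc (k≤degree none))

  bound-on : ∀ U → Acc _⊂_ U → Bound U
  bound-on U (acc rec) with nonempty? U
  ... | no empty = record
    { k       = 0
    ; colour  = λ _ → 0
    ; colour< = λ x∈ → contradiction (_ , x∈) empty
    ; proper  = λ x∈ → contradiction (_ , x∈) empty
    ; cycles  = []
    ; unique  = []
    ; induced = λ ()
    ; links   = []
    ; covers  = λ x∈ → contradiction (_ , x∈) empty
    ; bound   = z≤n
    }
  ... | yes nonempty with y , avoidable ← avoidable-exists U (acc rec) nonempty =
    insertAvoidable avoidable (bound-on (U ∖ y) (rec (x∈p⇒p-x⊂p (proj₁ avoidable))))

-- The bound for the whole graph

∈-subsets : ∀ (S : Subset n) → S ∈ˡ subsets n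
∈-subsets Vec.[]            = here refl
∈-subsets (inside Vec.∷ S)  = ∈-++⁺ˡ (∈-map⁺ (inside Vec.∷_) (∈-subsets S))
∈-subsets (outside Vec.∷ S) = ∈-++⁺ʳ (map (inside Vec.∷_) (subsets _)) (∈-map⁺ (outside Vec.∷_) (∈-subsets S))

∈-edges⁻ : ∀ (G : Graph n) {u v} → (u , v) ∈ˡ edges G → u <ᶠ v × Graph.Adj G u v
∈-edges⁻ {n} G uv∈ = proj₂ (∈-filter⁻ _ {xs = cartesianProduct (allFin n) (allFin n)} uv∈)

∈-edges⁺ : ∀ (G : Graph n) {u v} → u <ᶠ v → Graph.Adj G u v → (u , v) ∈ˡ edges G
∈-edges⁺ G {u} {v} u<v u~v = ∈-filter⁺ _ (∈-cartesianProduct⁺ (∈-allFin u) (∈-allFin v)) (u<v , u~v)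

edges-unique : ∀ (G : Graph n) → Unique (edges G)
edges-unique {n} G = Unique.filter⁺ _ (Unique.cartesianProduct⁺ (Unique.allFin⁺ n) (Unique.allFin⁺ n))

-- `links` contains every edge, `cycles` lists only induced cycles without repetition, and `k`
-- colours suffice: all three replacements go the right way.
bethComplete-χ : ∀ (G : Graph n) →
                 length (edges G) ℕ.+ bethComplete (χ G) ℕ.≤ length (inducedCycles G) ℕ.+ n
bethComplete-χ {n} G = begin
  length (edges G) ℕ.+ bethComplete (χ G)  ≤⟨ ℕ.+-mono-≤ edges≤links (bethComplete-mono χ≤k) ⟩
  length links ℕ.+ bethComplete k          ≤⟨ bound ⟩
  length cycles ℕ.+ ∣ ⊤ {n} ∣              ≤⟨ ℕ.+-mono-≤ cycles≤ (ℕ.≤-reflexive (∣⊤∣≡n n)) ⟩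
  length (inducedCycles G) ℕ.+ n           ∎
  where
  open ℕ.≤-Reasoning
  open Induction G
  open Bound (bound-on ⊤ (⊂-wellFounded ⊤))

  edges≤links : length (edges G) ℕ.≤ length links
  edges≤links = length-mono-⊆ (edges-unique G) λ uv∈ →
    let u<v , u~v = ∈-edges⁻ G uv∈ in covers ∈⊤ ∈⊤ u<v u~v

  cycles≤ : length cycles ℕ.≤ length (inducedCycles G)
  cycles≤ = length-mono-⊆ unique λ S∈ → ∈-filter⁺ (inducesCycle? G) (∈-subsets _) (proj₂ (induced S∈))

  χ≤k : χ G ℕ.≤ k
  χ≤k = proj₂ (proj₂ (chromatic G)) k
    ( (λ x → fromℕ< (colour< (∈⊤ {x = x})))
    , λ u v u~v eq → proper ∈⊤ ∈⊤ u~v (Fin.fromℕ<-injective _ _ _ _ eq))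

-- Induced cycles and edges of complete graphs

length-filter-map : {P : A → Set} {Q : B → Set} (P? : Decidable P) (Q? : Decidable Q) (f : A → B) →
                    (∀ x → P x ⇔ Q (f x)) → ∀ xs → length (filter Q? (map f xs)) ≡ length (filter P? xs)
length-filter-map P? Q? f P⇔Q []       = refl
length-filter-map P? Q? f P⇔Q (x ∷ xs) with P? x | Q? (f x)
... | yes _  | yes _  = cong suc (length-filter-map P? Q? f P⇔Q xs)
... | no  _  | no  _  = length-filter-map P? Q? f P⇔Q xs
... | yes px | no ¬qx = contradiction (to (P⇔Q x) px) ¬qx
... | no ¬px | yes qx = contradiction (from (P⇔Q x) qx) ¬px

hasSize? : ∀ k → Decidable (λ (S : Subset n) → ∣ S ∣ ≡ k)
hasSize? k S = ∣ S ∣ ℕ.≟ k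

-- Pascal's rule, by whether the first vertex belongs to the subset; for `k = 0` no subset
-- containing it counts.
length-subsetsOfSize : ∀ n k → length (filter (hasSize? k) (subsets n)) ≡ n C k
length-subsetsOfSize zero    zero    = refl
length-subsetsOfSize zero    (suc k) = refl
length-subsetsOfSize (suc n) k       = begin
  length (filter (hasSize? k) (ins ++ outs))                            ≡⟨ cong length (filter-++ (hasSize? k) ins outs) ⟩
  length (filter (hasSize? k) ins ++ filter (hasSize? k) outs)          ≡⟨ length-++ (filter (hasSize? k) ins) ⟩
  length (filter (hasSize? k) ins) ℕ.+ length (filter (hasSize? k) outs) ≡⟨ cong₂ ℕ._+_ refl without ⟩
  length (filter (hasSize? k) ins) ℕ.+ n C k                            ≡⟨ split k ⟩
  suc n C k                                                             ∎
  where
  open ≡-Reasoning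
  ins outs : List (Subset (suc n))
  ins  = map (inside Vec.∷_) (subsets n)
  outs = map (outside Vec.∷_) (subsets n)

  without : length (filter (hasSize? k) outs) ≡ n C k
  without = trans (length-filter-map (hasSize? k) (hasSize? k) (outside Vec.∷_) (λ _ → mk⇔ id id) (subsets n))
                  (length-subsetsOfSize n k)

  split : ∀ k → length (filter (hasSize? k) ins) ℕ.+ n C k ≡ suc n C k
  split zero    = cong (λ Ss → length Ss ℕ.+ 1) (filter-none (hasSize? 0) (All.tabulate nonempty))
    where
    nonempty : ∀ {S} → S ∈ˡ ins → ∣ S ∣ ≢ 0
    nonempty S∈ with _ , _ , refl ← ∈-map⁻ (inside Vec.∷_) S∈ = λ ()
  split (suc k) = trans
    (cong (ℕ._+ n C suc k) (trans
      (length-filter-map (hasSize? k) (hasSize? (suc k)) (inside Vec.∷_)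
        (λ _ → mk⇔ (cong suc) ℕ.suc-injective) (subsets n))
      (length-subsetsOfSize n k)))
    (nCk+nC[k+1]≡[n+1]C[k+1] n k)

-- Indices 0 and 2 have distinct, hence adjacent, images, so they are adjacent in the cycle. Only
-- the wrap-around allows this, and it forces length 3.
K-cycle-size : ∀ {t} (S : Subset t) → InducesCycle (K t) S → ∣ S ∣ ≡ 3
K-cycle-size {t} S (k , f , inj , adj , img) with triangle
  where
  triangle : k ≡ 0
  triangle with from (adj zero (suc (suc zero))) (λ eq → contradiction (inj eq) λ ())
  ... | inj₁ (inj₁ ())
  ... | inj₁ (inj₂ (() , _))
  ... | inj₂ (inj₁ ())
  ... | inj₂ (inj₂ (eq , _)) = sym (ℕ.+-cancelˡ-≡ 2 0 k eq)
... | refl = ℕ.≤-antisym upper lower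
  where
  a b c : Fin t
  a = f zero
  b = f (suc zero)
  c = f (suc (suc zero))

  S⊆ : S ⊆ ⁅ a ⁆ ∪ (⁅ b ⁆ ∪ ⁅ c ⁆)
  S⊆ z∈ with to (img _) z∈
  ... | zero            , refl = x∈p∪q⁺ (inj₁ (x∈⁅x⁆ a))
  ... | suc zero        , refl = x∈p∪q⁺ (inj₂ (x∈p∪q⁺ (inj₁ (x∈⁅x⁆ b))))
  ... | suc (suc zero)  , refl = x∈p∪q⁺ (inj₂ (x∈p∪q⁺ (inj₂ (x∈⁅x⁆ c))))

  upper : ∣ S ∣ ℕ.≤ 3
  upper = begin
    ∣ S ∣                                  ≤⟨ p⊆q⇒∣p∣≤∣q∣ S⊆ ⟩
    ∣ ⁅ a ⁆ ∪ (⁅ b ⁆ ∪ ⁅ c ⁆) ∣            ≤⟨ ∣p∪q∣≤∣p∣+∣q∣ ⁅ a ⁆ (⁅ b ⁆ ∪ ⁅ c ⁆) ⟩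
    ∣ ⁅ a ⁆ ∣ ℕ.+ ∣ ⁅ b ⁆ ∪ ⁅ c ⁆ ∣        ≤⟨ ℕ.+-monoʳ-≤ ∣ ⁅ a ⁆ ∣ (∣p∪q∣≤∣p∣+∣q∣ ⁅ b ⁆ ⁅ c ⁆) ⟩
    ∣ ⁅ a ⁆ ∣ ℕ.+ (∣ ⁅ b ⁆ ∣ ℕ.+ ∣ ⁅ c ⁆ ∣) ≡⟨ cong₂ ℕ._+_ (∣⁅x⁆∣≡1 a) (cong₂ ℕ._+_ (∣⁅x⁆∣≡1 b) (∣⁅x⁆∣≡1 c)) ⟩
    3                                      ∎
    where open ℕ.≤-Reasoning

  f∈ : ∀ i → f i ∈ S
  f∈ i = from (img (f i)) (i , refl)

  b∈ : b ∈ S ∖ a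
  b∈ = x∈p∧x≢y⇒x∈p-y (f∈ _) (λ eq → contradiction (inj eq) λ ())

  c∈ : c ∈ S ∖ a ∖ b
  c∈ = x∈p∧x≢y⇒x∈p-y (x∈p∧x≢y⇒x∈p-y (f∈ _) (λ eq → contradiction (inj eq) λ ()))
                      (λ eq → contradiction (inj eq) λ ())

  -- By injectivity `a`, `b`, `c` are distinct, and each deletion in turn lowers the size.
  lower : 3 ℕ.≤ ∣ S ∣
  lower = begin
    3                               ≤⟨ s≤s (s≤s (s≤s z≤n)) ⟩
    3 ℕ.+ ∣ S ∖ a ∖ b ∖ c ∣         ≤⟨ s≤s (s≤s (x∈p⇒∣p-x∣<∣p∣ c∈)) ⟩
    2 ℕ.+ ∣ S ∖ a ∖ b ∣             ≤⟨ s≤s (x∈p⇒∣p-x∣<∣p∣ b∈) ⟩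
    1 ℕ.+ ∣ S ∖ a ∣                 ≤⟨ x∈p⇒∣p-x∣<∣p∣ (f∈ zero) ⟩
    ∣ S ∣                           ∎
    where open ℕ.≤-Reasoning

-- An upper estimate of the cycles, paired with a lower one of the edges, bounds `ℶ² (K t)` from
-- above.
K-cycles : ∀ t → length (inducedCycles (K t)) ℕ.≤ t C 3
K-cycles t = ℕ.≤-trans
  (Sublist.length-mono-≤ (Sublist.filter⁺ (inducesCycle? (K t)) (hasSize? 3)
    (λ { {S} refl → K-cycle-size S }) (⊆-refl {x = subsets t})))
  (ℕ.≤-reflexive (length-subsetsOfSize t 3))

K-edges : ∀ t → t C 2 ℕ.≤ length (edges (K t))
K-edges t = begin
  t C 2                        ≡⟨ cong (_C 2) (length-tabulate {n = t} id) ⟨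
  length (allFin t) C 2        ≡⟨ length-pairs (allFin t) ⟨
  length (pairs (allFin t))    ≤⟨ length-mono-⊆ (pairs-unique (Unique.allFin⁺ t)) pairs⊆edges ⟩
  length (edges (K t))         ∎
  where
  open ℕ.≤-Reasoning
  pairs⊆edges : pairs (allFin t) ⊆ˡ edges (K t)
  pairs⊆edges p∈ with _ , _ , u<v ← ∈-pairs⁻ (allFin-sorted t) p∈ =
    ∈-edges⁺ (K t) u<v (Fin.<⇒≢ u<v)

-- Comparison of second characteristics

-- Translation by - e₁ - e₂ carries the subtraction-free inequality in ℕ to the one in ℤ.
characteristic-mono : ∀ c₁ e₁ v₁ c₂ e₂ v₂ → c₁ ℕ.+ v₁ ℕ.+ e₂ ℕ.≤ c₂ ℕ.+ v₂ ℕ.+ e₁ →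
                      + c₁ - + e₁ + + v₁ ≤ + c₂ - + e₂ + + v₂
characteristic-mono c₁ e₁ v₁ c₂ e₂ v₂ le = begin
  + c₁ - + e₁ + + v₁                            ≡⟨ shift (+ c₁) (+ e₁) (+ v₁) (+ e₂) ⟩
  + (c₁ ℕ.+ v₁ ℕ.+ e₂) + (- (+ e₁) - + e₂)      ≤⟨ ℤ.+-monoˡ-≤ (- (+ e₁) - + e₂) (+≤+ le) ⟩
  + (c₂ ℕ.+ v₂ ℕ.+ e₁) + (- (+ e₁) - + e₂)      ≡⟨ cong (λ z → + (c₂ ℕ.+ v₂ ℕ.+ e₁) + z) (ℤ.+-comm (- (+ e₁)) (- (+ e₂))) ⟩
  + (c₂ ℕ.+ v₂ ℕ.+ e₁) + (- (+ e₂) - + e₁)      ≡⟨ shift (+ c₂) (+ e₂) (+ v₂) (+ e₁) ⟨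
  + c₂ - + e₂ + + v₂                            ∎
  where
  open ℤ.≤-Reasoning
  shift : ∀ c e v x → c - e + v ≡ (c + v + x) + (- e - x)
  shift = solve 4 (λ c e v x → c :- e :+ v := (c :+ v :+ x) :+ (:- e :- x)) refl
    where open ℤ-Solver

-- Leaving `c` and `e` free covers both conjuncts of the theorem: the actual counts in the complete
-- graph, and the binomials themselves.
characteristic-≥ : ∀ (G : Graph n) c e → c ℕ.≤ χ G C 3 → χ G C 2 ℕ.≤ e →
                   + c - + e + + χ G ≤ ℶ² G
characteristic-≥ {n} G c e c≤ ≤e = characteristic-mono c e x (length (inducedCycles G)) E n (begin
  c ℕ.+ x ℕ.+ E                           ≤⟨ ℕ.+-monoˡ-≤ E (ℕ.+-monoˡ-≤ x c≤) ⟩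
  x C 3 ℕ.+ x ℕ.+ E                       ≡⟨ cong (ℕ._+ E) (bethComplete-binomial x) ⟨
  bethComplete x ℕ.+ x C 2 ℕ.+ E          ≡⟨ solve 3 (λ f b e → f :+ b :+ e := e :+ f :+ b) refl (bethComplete x) (x C 2) E ⟩
  E ℕ.+ bethComplete x ℕ.+ x C 2          ≤⟨ ℕ.+-mono-≤ (bethComplete-χ G) ≤e ⟩
  length (inducedCycles G) ℕ.+ n ℕ.+ e    ∎)
  where
  open ℕ.≤-Reasoning
  open +-*-Solver
  x = χ G
  E = length (edges G)

corollary3p2p1 : ∀ (n : ℕ) (G : Graph n) → Connected G →
    (ℶ² (K (χ G)) ≤ ℶ² G) ×
    (+ (χ G C 3) - + (χ G C 2) + + (χ G C 1) ≤ ℶ² G)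
corollary3p2p1 n G _ =
  characteristic-≥ G (length (inducedCycles (K (χ G)))) (length (edges (K (χ G)))) (K-cycles (χ G)) (K-edges (χ G)) ,
  subst (λ m → + (χ G C 3) - + (χ G C 2) + + m ≤ ℶ² G) (sym (nC1≡n (χ G)))
    (characteristic-≥ G (χ G C 3) (χ G C 2) ℕ.≤-refl ℕ.≤-refl)
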